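{- For $3\le D\le 20000$ there is no graph of degree $9$, diameter $D$ and cyclic defect. Furthermore, for odd $g$ with $7\le g\le 40001$ there is no graph of degree $9$, girth $g$ and cyclic excess.
   Context: For an integer $d\ge 1$ define polynomials $G_{d,m}(x)$ by $G_{d,0}(x)=1$, $G_{d,1}(x)=x+1$, and $G_{d,m+1}(x)=xG_{d,m}(x)-(d-1)G_{d,m-1}(x)$ for $m\ge1$. Let $J_n$ be the $n\times n$ all-ones matrix. For a graph on $n\ge3$ vertices, a cycle matrix is the adjacency matrix $B$ of an $n$-cycle on the same vertex set (i.e., for some ordering $v_1,\dots,v_n$ of the vertices, $B_{ij}=1$ iff $v_i,v_j$ are cyclically consecutive, and $0$ otherwise); this cycle need not consist of edges of the graph. A graph $\Gamma$ of order $n$ with adjacency matrix $A$ is a graph of degree $d$, diameter $D$ and cyclic defect if $\Gamma$ is $d$-regular with $d\ge3$, has diameter $D\ge2$, and $G_{d,D}(A)=J_n+B$ for some cycle matrix $B$. It is a graph of degree $d$, girth $g$ and cyclic excess if $\Gamma$ is $d$-regular with $d\ge3$, has odd girth $g\ge5$, and $G_{d,\lfloor g/2\rfloor}(A)=J_n-B$ for some cycle matrix $B$. -}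

module Defs where

open import Data.Nat as ℕ using (ℕ; zero; suc; _≤_; _∸_)
open import Data.Nat.DivMod using (_/_)
open import Data.Integer as ℤ using (ℤ; +_; _-_)
open import Data.Fin using (Fin; toℕ; _≟_)
import Data.Fin as Fin
open import Relation.Nullary using (yes; no)
open import Data.Fin.Permutation using (Permutation′; _⟨$⟩ʳ_)
open import Data.Bool using (Bool; true; false; if_then_else_)
open import Data.Product using (Σ; _×_; ∃; ∃-syntax; _,_)
open import Data.Sum using (_⊎_)
open import Relation.Nullary using (¬_)
open import Relation.Binary.PropositionalEquality using (_≡_)
open import Function.Definitions using (Injective)

record Graph (n : ℕ) : Set where
  field
    adj   : Fin n → Fin n → Bool
    sym   : ∀ i j → adj i j ≡ adj j i
    irrefl : ∀ i → adj i i ≡ false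
open Graph public

sumFin : ∀ {A : Set} → (A → A → A) → A → ∀ n → (Fin n → A) → A
sumFin _⊕_ e zero    f = e
sumFin _⊕_ e (suc n) f = f Fin.zero ⊕ sumFin _⊕_ e n (λ i → f (Fin.suc i))

Mat : ℕ → Set
Mat n = Fin n → Fin n → ℤ

_≐_ : ∀ {n} → Mat n → Mat n → Set
M ≐ N = ∀ i j → M i j ≡ N i j

idM : ∀ {n} → Mat n
idM i j with i ≟ j
... | yes _ = + 1
... | no  _ = + 0

J : ∀ n → Mat n
J n i j = + 1

_+M_ : ∀ {n} → Mat n → Mat n → Mat n
(M +M N) i j = M i j ℤ.+ N i j

_-M_ : ∀ {n} → Mat n → Mat n → Mat n
(M -M N) i j = M i j ℤ.- N i j

_·M_ : ℤ → ∀ {n} → Mat n → Mat n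
(c ·M M) i j = c ℤ.* M i j

_*M_ : ∀ {n} → Mat n → Mat n → Mat n
_*M_ {n} M N i j = sumFin ℤ._+_ (+ 0) n (λ k → M i k ℤ.* N k j)

adjMat : ∀ {n} → Graph n → Mat n
adjMat G i j = if adj G i j then + 1 else + 0

Gpoly : ℕ → ∀ {n} → Mat n → ℕ → Mat n
Gpoly d A zero = idM
Gpoly d A (suc zero) = A +M idM
Gpoly d A (suc (suc m)) =
  (A *M Gpoly d A (suc m)) -M ((+ (d ∸ 1)) ·M Gpoly d A m)

degree : ∀ {n} → Graph n → Fin n → ℕ
degree {n} G i = sumFin ℕ._+_ 0 n (λ j → if adj G i j then 1 else 0)

Regular : ∀ {n} → ℕ → Graph n → Set
Regular d G = ∀ i → degree G i ≡ d

data Walk {n} (G : Graph n) : Fin n → Fin n → ℕ → Set where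
  here : ∀ {u} → Walk G u u 0
  step : ∀ {u v w k} → adj G u v ≡ true → Walk G v w k → Walk G u w (suc k)

HasDiameter : ∀ {n} → Graph n → ℕ → Set
HasDiameter {n} G D =
  (∀ u v → ∃[ k ] (k ≤ D × Walk G u v k)) ×
  (∃[ u ] ∃[ v ] (∀ k → Walk G u v k → D ≤ k))

CycSucc : ∀ m → Fin m → Fin m → Set
CycSucc m k l = (toℕ l ≡ suc (toℕ k)) ⊎ ((suc (toℕ k) ≡ m) × (toℕ l ≡ 0))

CycConsec : ∀ m → Fin m → Fin m → Set
CycConsec m k l = CycSucc m k l ⊎ CycSucc m l k

Cycle : ∀ {n} → Graph n → ℕ → Set
Cycle {n} G ℓ = (3 ≤ ℓ) × Σ (Fin ℓ → Fin n) (λ f →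
  Injective _≡_ _≡_ f × (∀ k l → CycSucc ℓ k l → adj G (f k) (f l) ≡ true))

HasGirth : ∀ {n} → Graph n → ℕ → Set
HasGirth G g = Cycle G g × (∀ ℓ → Cycle G ℓ → g ≤ ℓ)

Odd : ℕ → Set
Odd g = ∃[ k ] g ≡ suc (2 ℕ.* k)

IsCycleMatrix : ∀ n → Mat n → Set
IsCycleMatrix n B = (3 ≤ n) × Σ (Permutation′ n) (λ σ → ∀ k l →
  (CycConsec n k l → B (σ ⟨$⟩ʳ k) (σ ⟨$⟩ʳ l) ≡ + 1) ×
  (¬ CycConsec n k l → B (σ ⟨$⟩ʳ k) (σ ⟨$⟩ʳ l) ≡ + 0))

CyclicDefect : ∀ {n} → ℕ → ℕ → Graph n → Set
CyclicDefect {n} d D G =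
  (3 ≤ d) × Regular d G × (2 ≤ D) × HasDiameter G D ×
  (∃[ B ] (IsCycleMatrix n B × (Gpoly d (adjMat G) D ≐ (J n +M B))))

CyclicExcess : ∀ {n} → ℕ → ℕ → Graph n → Set
CyclicExcess {n} d g G =
  (3 ≤ d) × Regular d G × Odd g × (5 ≤ g) × HasGirth G g ×
  (∃[ B ] (IsCycleMatrix n B × (Gpoly d (adjMat G) (g / 2) ≐ (J n -M B))))

{-# OPTIONS --safe #-}

-- Counting edge ends, 9n is even, so n is even and the vector v alternating in sign along the cycle
-- satisfies Bv = −2v and Jv = 0.  The (−2)-eigenspace of a cycle matrix of even order is one-dimensional
-- and A, being regular and commuting with G(A) = J ± B, preserves it; hence Av = xv with x an integer,
-- |x| ≤ 9 and G(x) = ∓2.  For each of the 19 candidates x, running the recurrence modulo 10⁹ + 7 shows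
-- G(x)² ≠ 4 for all indices from 3 to 20000.
module Submission where

open import Defs hiding (sym)
import Algebra.Properties.CommutativeMonoid.Sum as MonoidSum
import Algebra.Properties.Semiring.Sum as SemiringSum
open import Data.Bool using (Bool; true; false; not; _∧_; T; if_then_else_)
open import Data.Bool.Properties using (T?; T-∧)
open import Data.Empty using (⊥-elim)
open import Data.Fin as Fin using (Fin; toℕ; punchIn; punchOut)
open import Data.Fin.Permutation using (Permutation′; _⟨$⟩ʳ_; _⟨$⟩ˡ_; inverseˡ; inverseʳ)
import Data.Fin.Properties as Fin
open import Data.Integer as ℤ using (ℤ; +_; -[1+_]; ∣_∣; -1ℤ)
import Data.Integer.Properties as ℤ
open import Data.Integer.Tactic.RingSolver using (solve-∀)
open import Data.Nat as ℕ using (ℕ; zero; suc; _≤_; _<_; s≤s; z≤n; _∸_; _≡ᵇ_; NonZero; >-nonZero)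
open import Data.Nat.Coprimality using (coprime?; coprime-divisor)
open import Data.Nat.Divisibility using (_∣_; divides)
open import Data.Nat.DivMod
import Data.Nat.Properties as ℕ
import Data.Nat.Tactic.RingSolver as ℕ-Solver
open import Data.Product using (_×_; _,_; ∃; proj₁; proj₂)
open import Data.Sum using (inj₁; inj₂)
open import Data.Vec.Functional using (foldr)
open import Function using (_∘_; Equivalence)
open import Relation.Binary.PropositionalEquality hiding (J)
open import Relation.Nullary using (¬_; yes; no; contradiction)
open import Relation.Nullary.Decidable using (toWitness; _×-dec_)

-- The recurrence at an integer argument and its residues.

Gval : ℕ → ℤ → ℕ → ℤ
Gval d x zero = + 1
Gval d x (suc zero) = x ℤ.+ + 1
Gval d x (suc (suc m)) = x ℤ.* Gval d x (suc m) ℤ.- (+ (d ∸ 1)) ℤ.* Gval d x m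

module Residues (M d : ℕ) .{{_ : NonZero M}} (d≤M : d ∸ 1 ≤ M) where

  infix 4 _≃_
  -- Congruence modulo M of an integer with a natural representative, reduced or not: sums and
  -- products are formed first and reduced once per step, so the long computation stays in ℕ.
  _≃_ : ℤ → ℕ → Set
  x ≃ a = ∃ λ q → x ≡ + a ℤ.+ q ℤ.* + M

  ≃-% : ∀ {x a} → x ≃ a → x ≃ a % M
  ≃-% {x} {a} (q , eq) = + (a / M) ℤ.+ q , (begin
    x                                                 ≡⟨ eq ⟩
    + a ℤ.+ q ℤ.* + M
      ≡⟨ cong (λ z → + z ℤ.+ q ℤ.* + M) (m≡m%n+[m/n]*n a M) ⟩
    + (a % M ℕ.+ a / M ℕ.* M) ℤ.+ q ℤ.* + M
      ≡⟨ cong (λ z → + (a % M) ℤ.+ z ℤ.+ q ℤ.* + M) (ℤ.pos-* (a / M) M) ⟩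
    + (a % M) ℤ.+ + (a / M) ℤ.* + M ℤ.+ q ℤ.* + M
      ≡⟨ regroup (+ (a % M)) (+ (a / M)) q (+ M) ⟩
    + (a % M) ℤ.+ (+ (a / M) ℤ.+ q) ℤ.* + M           ∎)
    where
    open ≡-Reasoning
    regroup : ∀ r s q m → r ℤ.+ s ℤ.* m ℤ.+ q ℤ.* m ≡ r ℤ.+ (s ℤ.+ q) ℤ.* m
    regroup = solve-∀

  -- The sign of the quotient decides on which side a multiple of M is added, so that the equation
  -- can be read in ℕ.
  ≃⇒%≡% : ∀ {a b} → + a ≃ b → a % M ≡ b % M
  ≃⇒%≡% {a} {b} (+ k , eq) = trans
    (cong (_% M) (ℤ.+-injective (trans eq (cong (λ z → + b ℤ.+ z) (sym (ℤ.pos-* k M))))))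
    ([m+kn]%n≡m%n b k M)
  ≃⇒%≡% {a} {b} (-[1+ k ] , eq) = sym (trans
    (cong (_% M) (ℤ.+-injective (begin
      + b                                         ≡⟨ move (+ b) (+ suc k) (+ M) ⟩
      + b ℤ.+ -[1+ k ] ℤ.* + M ℤ.+ + suc k ℤ.* + M
        ≡⟨ cong₂ ℤ._+_ (sym eq) (sym (ℤ.pos-* (suc k) M)) ⟩
      + (a ℕ.+ suc k ℕ.* M)                       ∎)))
    ([m+kn]%n≡m%n a (suc k) M))
    where
    open ≡-Reasoning
    move : ∀ b k m → b ≡ b ℤ.+ (ℤ.- k) ℤ.* m ℤ.+ k ℤ.* m
    move = solve-∀

  ≃-* : ∀ {x y a b} → x ≃ a → y ≃ b → x ℤ.* y ≃ a ℕ.* b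
  ≃-* {a = a} {b} (p , refl) (q , refl) =
    s , trans (expand (+ a) (+ b) p q (+ M)) (cong (λ z → z ℤ.+ s ℤ.* + M) (sym (ℤ.pos-* a b)))
    where
    s = + a ℤ.* q ℤ.+ p ℤ.* + b ℤ.+ p ℤ.* q ℤ.* + M
    expand : ∀ a b p q m → (a ℤ.+ p ℤ.* m) ℤ.* (b ℤ.+ q ℤ.* m) ≡
      a ℤ.* b ℤ.+ (a ℤ.* q ℤ.+ p ℤ.* b ℤ.+ p ℤ.* q ℤ.* m) ℤ.* m
    expand = solve-∀

  ≃-+ : ∀ {x y a b} → x ≃ a → y ≃ b → x ℤ.+ y ≃ a ℕ.+ b
  ≃-+ {a = a} {b} (p , refl) (q , refl) = p ℤ.+ q , expand (+ a) (+ b) p q (+ M)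
    where
    expand : ∀ a b p q m → (a ℤ.+ p ℤ.* m) ℤ.+ (b ℤ.+ q ℤ.* m) ≡
      (a ℤ.+ b) ℤ.+ (p ℤ.+ q) ℤ.* m
    expand = solve-∀

  ≃-refl : ∀ {a} → + a ≃ a
  ≃-refl {a} = + 0 , sym (ℤ.+-identityʳ (+ a))

  ≃-neg : ∀ {a} → a ≤ M → ℤ.- + a ≃ M ∸ a
  ≃-neg {a} a≤M = -[1+ 0 ] , (begin
    ℤ.- + a                                  ≡⟨ shift (+ a) (+ M) ⟩
    (+ M ℤ.- + a) ℤ.+ -[1+ 0 ] ℤ.* + M
      ≡⟨ cong (ℤ._+ -[1+ 0 ] ℤ.* + M) (trans (ℤ.m-n≡m⊖n M a) (ℤ.⊖-≥ a≤M)) ⟩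
    + (M ∸ a) ℤ.+ -[1+ 0 ] ℤ.* + M           ∎)
    where
    open ≡-Reasoning
    shift : ∀ a m → ℤ.- a ≡ (m ℤ.+ ℤ.- a) ℤ.+ (ℤ.- + 1) ℤ.* m
    shift = solve-∀

  -- `M ∸ (d ∸ 1)` represents -(d - 1); by `d≤M` this subtraction is not truncated.
  next : ℕ → ℕ → ℕ → ℕ
  next r a b = (r ℕ.* b ℕ.+ (M ∸ (d ∸ 1)) ℕ.* a) % M

  -- The value under test is `b`, the second of the pair. Comparing its square with 4 excludes at
  -- once 2 and -2, the targets for excess and for defect.
  avoids±2 : ℕ → ℕ → ℕ → ℕ → Bool
  avoids±2 zero    r a b = true
  avoids±2 (suc k) r a b = not (b ℕ.* b % M ≡ᵇ 4 % M) ∧ avoids±2 k r b (next r a b)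

  next-≃ : ∀ {x r a b} m → x ≃ r → Gval d x m ≃ a → Gval d x (suc m) ≃ b →
           Gval d x (suc (suc m)) ≃ next r a b
  next-≃ {x} m x≃r ga gb = ≃-% (subst (_≃ _)
    (cong (λ z → x ℤ.* Gval d x (suc m) ℤ.+ z) (sym (ℤ.neg-distribˡ-* (+ (d ∸ 1)) (Gval d x m))))
    (≃-+ (≃-* x≃r gb) (≃-* (≃-neg d≤M) ga)))

  -- Congruent integers have equal residues, so a residue of b² other than that of 4 rules out the
  -- value 4. The tested indices begin at `suc m`, the index of `b`.
  avoids-sound : ∀ {x r} → x ≃ r → ∀ k m {a b} → Gval d x m ≃ a → Gval d x (suc m) ≃ b →
    T (avoids±2 k r a b) → ∀ i → i < k → Gval d x (suc (i ℕ.+ m)) ℤ.* Gval d x (suc (i ℕ.+ m)) ≢ + 4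
  avoids-sound x≃r (suc k) m {a} {b} ga gb t zero _ sq =
    not-T (b ℕ.* b % M ≡ᵇ 4 % M) (proj₁ (Equivalence.to T-∧ t))
      (ℕ.≡⇒≡ᵇ _ _ (sym (≃⇒%≡% (subst (_≃ _) sq (≃-* gb gb)))))
    where
    not-T : ∀ b → T (not b) → ¬ T b
    not-T true ()
    not-T false _ ()
  avoids-sound {x} x≃r (suc k) m ga gb t (suc i) (s≤s i<k) sq =
    avoids-sound x≃r k (suc m) gb (next-≃ m x≃r ga gb) (proj₂ (Equivalence.to T-∧ t)) i i<k
      (subst (λ j → Gval d x (suc j) ℤ.* Gval d x (suc j) ≡ + 4) (sym (ℕ.+-suc i m)) sq)

  -- For d = 9 smaller indices do reach ±2: G₁(1) = 2 and G₁(−3) = G₂(−3) = G₂(2) = −2.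
  avoidsFrom3 : ℕ → ℕ → Bool
  avoidsFrom3 k r = avoids±2 k r (next r 1 (r ℕ.+ 1)) (next r (r ℕ.+ 1) (next r 1 (r ℕ.+ 1)))

  avoidsFrom3-sound : ∀ {x r} → x ≃ r → ∀ k → T (avoidsFrom3 k r) → ∀ i → i < k →
    Gval d x (suc (i ℕ.+ 2)) ℤ.* Gval d x (suc (i ℕ.+ 2)) ≢ + 4
  -- The run starts from the pair with indices 2 and 3, so the first value tested is G₃.
  avoidsFrom3-sound x≃r k = avoids-sound x≃r k 2 g₂ (next-≃ 1 x≃r g₁ g₂)
    where
    g₁ = ≃-+ x≃r ≃-refl
    g₂ = next-≃ 0 x≃r ≃-refl g₁

-- The modulus is only required to produce no accidental collision with ±2 (2³¹ − 1, for example, fails).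
open Residues 1000000007 9 (ℕ.m≤m+n 8 999999999)

-- The candidates are k and -k for k up to 9, the latter as the residue M - k; zero occurs in both
-- forms. The bound 19998 counts the indices from 3 to 20000, and the whole check is decided by
-- evaluation.
avoidance : ∀ {k} → k < 10 → T (avoidsFrom3 19998 k) × T (avoidsFrom3 19998 (1000000007 ∸ k))
avoidance = toWitness
  {a? = ℕ.allUpTo? (λ k → T? (avoidsFrom3 19998 k) ×-dec T? (avoidsFrom3 19998 (1000000007 ∸ k))) 10} _

Gval²≢4 : ∀ {x m} → ∣ x ∣ ≤ 9 → 3 ≤ m → m ≤ 20000 → Gval 9 x m ℤ.* Gval 9 x m ≢ + 4
Gval²≢4 {x} {m} |x|≤9 3≤m m≤20000 =
  subst (λ j → Gval 9 x j ℤ.* Gval 9 x j ≢ + 4)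
    (trans (sym (ℕ.+-suc (m ∸ 3) 2)) (ℕ.m∸n+n≡m 3≤m)) (go x |x|≤9)
  where
  i<19998 : m ∸ 3 < 19998
  i<19998 = s≤s (ℕ.∸-monoˡ-≤ 3 m≤20000)
  go : ∀ x → ∣ x ∣ ≤ 9 → Gval 9 x (suc (m ∸ 3 ℕ.+ 2)) ℤ.* Gval 9 x (suc (m ∸ 3 ℕ.+ 2)) ≢ + 4
  go (+ k) k≤9 = avoidsFrom3-sound ≃-refl 19998 (proj₁ (avoidance (s≤s k≤9))) (m ∸ 3) i<19998
  go -[1+ k ] k<9 = avoidsFrom3-sound (≃-neg (ℕ.≤-trans k<9 (ℕ.m≤m+n 9 999999998))) 19998
    (proj₂ (avoidance (s≤s k<9))) (m ∸ 3) i<19998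

-- Finite sums.

open SemiringSum ℤ.+-*-semiring
  using (sum; ∑-distrib-+; ∑-comm; sum-cong-≗; sum-permute; sum-remove; sum-replicate-zero; *-distribˡ-sum; *-distribʳ-sum)
module ℕSum = MonoidSum ℕ.+-0-commutativeMonoid

-- Carries the sums in `degree` and `_*M_` over to library sums, with their laws of exchange,
-- removal and permutation.
sumFin≡foldr : ∀ {A : Set} (_⊕_ : A → A → A) e n f → sumFin _⊕_ e n f ≡ foldr _⊕_ e f
sumFin≡foldr _⊕_ e zero f = refl
sumFin≡foldr _⊕_ e (suc n) f = cong (f Fin.zero ⊕_) (sumFin≡foldr _⊕_ e n (f ∘ Fin.suc))

sum-supported₁ : ∀ {n} (f : Fin n → ℤ) a → (∀ l → l ≢ a → f l ≡ + 0) → sum f ≡ f a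
sum-supported₁ {suc n} f a f≡0 = begin
  sum f                          ≡⟨ sum-remove {i = a} f ⟩
  f a ℤ.+ sum (f ∘ punchIn a)
    ≡⟨ cong (λ z → f a ℤ.+ z) (trans (sum-cong-≗ (λ l → f≡0 _ (Fin.punchInᵢ≢i a l))) (sum-replicate-zero n)) ⟩
  f a ℤ.+ + 0                    ≡⟨ ℤ.+-identityʳ (f a) ⟩
  f a                            ∎
  where open ≡-Reasoning

sum-supported₂ : ∀ {n} (f : Fin n → ℤ) {a b} → a ≢ b →
                 (∀ l → l ≢ a → l ≢ b → f l ≡ + 0) → sum f ≡ f a ℤ.+ f b
sum-supported₂ {suc n} f {a} {b} a≢b f≡0 = begin
  sum f                                           ≡⟨ sum-remove {i = a} f ⟩
  f a ℤ.+ sum (f ∘ punchIn a)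
    ≡⟨ cong (λ z → f a ℤ.+ z) (sum-supported₁ (f ∘ punchIn a) (punchOut a≢b) λ l l≢ →
         f≡0 _ (Fin.punchInᵢ≢i a l)
               (λ eq → l≢ (Fin.punchIn-injective a _ _ (trans eq (sym (Fin.punchIn-punchOut a≢b)))))) ⟩
  f a ℤ.+ f (punchIn a (punchOut a≢b))            ≡⟨ cong (λ l → f a ℤ.+ f l) (Fin.punchIn-punchOut a≢b) ⟩
  f a ℤ.+ f b                                     ∎
  where open ≡-Reasoning

∣sum∣≤ : ∀ {n} (f : Fin n → ℤ) (g : Fin n → ℕ) → (∀ i → ∣ f i ∣ ≤ g i) → ∣ sum f ∣ ≤ ℕSum.sum g
∣sum∣≤ {zero} f g f≤g = z≤n
∣sum∣≤ {suc n} f g f≤g = ℕ.≤-trans (ℤ.∣i+j∣≤∣i∣+∣j∣ (f Fin.zero) (sum (f ∘ Fin.suc)))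
  (ℕ.+-mono-≤ (f≤g Fin.zero) (∣sum∣≤ (f ∘ Fin.suc) (g ∘ Fin.suc) (f≤g ∘ Fin.suc)))

pos-sum : ∀ {n} (g : Fin n → ℕ) → sum (λ i → + g i) ≡ + ℕSum.sum g
pos-sum {zero} g = refl
pos-sum {suc n} g = cong (λ z → + g Fin.zero ℤ.+ z) (pos-sum (g ∘ Fin.suc))

-- The first row and the first column have the same sum r by symmetry and meet in a zero, so they
-- contribute 2r; what remains is a smaller matrix of the same kind.
2∣sum-sym : ∀ {n} (f : Fin n → Fin n → ℕ) → (∀ i j → f i j ≡ f j i) → (∀ i → f i i ≡ 0) →
            ∃ λ q → ℕSum.sum (λ i → ℕSum.sum (f i)) ≡ q ℕ.* 2
2∣sum-sym {zero} f f-sym f-diag = 0 , refl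
2∣sum-sym {suc n} f f-sym f-diag
  with q , eq ← 2∣sum-sym (λ i j → f (Fin.suc i) (Fin.suc j)) (λ i j → f-sym _ _) (λ i → f-diag _)
  = r ℕ.+ q , (begin
    f Fin.zero Fin.zero ℕ.+ r ℕ.+ ℕSum.sum (λ i → f (Fin.suc i) Fin.zero ℕ.+ rest i)
      ≡⟨ cong₂ (λ x y → x ℕ.+ r ℕ.+ y) (f-diag Fin.zero) (ℕSum.∑-distrib-+ (λ i → f (Fin.suc i) Fin.zero) rest) ⟩
    r ℕ.+ (ℕSum.sum (λ i → f (Fin.suc i) Fin.zero) ℕ.+ ℕSum.sum rest)
      ≡⟨ cong₂ (λ x y → r ℕ.+ (x ℕ.+ y)) (ℕSum.sum-cong-≗ (λ i → f-sym (Fin.suc i) Fin.zero)) eq ⟩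
    r ℕ.+ (r ℕ.+ q ℕ.* 2)
      ≡⟨ double r q ⟩
    (r ℕ.+ q) ℕ.* 2 ∎)
  where
  open ≡-Reasoning
  r = ℕSum.sum (λ j → f Fin.zero (Fin.suc j))
  rest : Fin n → ℕ
  rest i = ℕSum.sum (λ j → f (Fin.suc i) (Fin.suc j))
  double : ∀ r q → r ℕ.+ (r ℕ.+ q ℕ.* 2) ≡ (r ℕ.+ q) ℕ.* 2
  double = ℕ-Solver.solve-∀

-- Matrices acting on integer vectors.

Vect : ℕ → Set
Vect n = Fin n → ℤ

infixr 8 _▷_ _·v_
_▷_ : ∀ {n} → Mat n → Vect n → Vect n
(M ▷ v) i = sum (λ j → M i j ℤ.* v j)

_·v_ : ∀ {n} → ℤ → Vect n → Vect n
(c ·v v) i = c ℤ.* v i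

▷-cong : ∀ {n} (M : Mat n) {v w} → v ≗ w → M ▷ v ≗ M ▷ w
▷-cong M v≗w i = sum-cong-≗ (λ j → cong (M i j ℤ.*_) (v≗w j))

▷-congˡ : ∀ {n} {M N : Mat n} → M ≐ N → ∀ v → M ▷ v ≗ N ▷ v
▷-congˡ M≐N v i = sum-cong-≗ (λ j → cong (ℤ._* v j) (M≐N i j))

▷-·v : ∀ {n} (M : Mat n) c v → M ▷ c ·v v ≗ c ·v (M ▷ v)
▷-·v M c v i = trans (sum-cong-≗ (λ j → swap (M i j) c (v j))) (sym (*-distribˡ-sum c (λ j → M i j ℤ.* v j)))
  where
  swap : ∀ a b c → a ℤ.* (b ℤ.* c) ≡ b ℤ.* (a ℤ.* c)
  swap = solve-∀

·M-▷ : ∀ {n} c (M : Mat n) v → (c ·M M) ▷ v ≗ c ·v (M ▷ v)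
·M-▷ c M v i = trans (sum-cong-≗ (λ j → ℤ.*-assoc c (M i j) (v j))) (sym (*-distribˡ-sum c (λ j → M i j ℤ.* v j)))

+M-▷ : ∀ {n} (M N : Mat n) v i → ((M +M N) ▷ v) i ≡ (M ▷ v) i ℤ.+ (N ▷ v) i
+M-▷ M N v i = trans (sum-cong-≗ (λ j → ℤ.*-distribʳ-+ (v j) (M i j) (N i j)))
                     (∑-distrib-+ (λ j → M i j ℤ.* v j) (λ j → N i j ℤ.* v j))

▷-+ : ∀ {n} (M : Mat n) v w i → (M ▷ (λ j → v j ℤ.+ w j)) i ≡ (M ▷ v) i ℤ.+ (M ▷ w) i
▷-+ M v w i = trans (sum-cong-≗ (λ j → ℤ.*-distribˡ-+ (M i j) (v j) (w j)))
                    (∑-distrib-+ (λ j → M i j ℤ.* v j) (λ j → M i j ℤ.* w j))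

*M-▷ : ∀ {n} (M N : Mat n) v → (M *M N) ▷ v ≗ M ▷ N ▷ v
*M-▷ {n} M N v i = begin
  sum (λ j → (M *M N) i j ℤ.* v j)
    ≡⟨ sum-cong-≗ (λ j → trans (cong (ℤ._* v j) (sumFin≡foldr ℤ._+_ (+ 0) n (λ k → M i k ℤ.* N k j)))
                               (*-distribʳ-sum (v j) (λ k → M i k ℤ.* N k j))) ⟩
  sum (λ j → sum (λ k → M i k ℤ.* N k j ℤ.* v j))
    ≡⟨ ∑-comm (λ j k → M i k ℤ.* N k j ℤ.* v j) ⟩
  sum (λ k → sum (λ j → M i k ℤ.* N k j ℤ.* v j))
    ≡⟨ sum-cong-≗ (λ k → trans (sum-cong-≗ (λ j → ℤ.*-assoc (M i k) (N k j) (v j)))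
                               (sym (*-distribˡ-sum (M i k) (λ j → N k j ℤ.* v j)))) ⟩
  sum (λ k → M i k ℤ.* sum (λ j → N k j ℤ.* v j)) ∎
  where open ≡-Reasoning

-M-·M-▷ : ∀ {n} c (M N : Mat n) v i → ((M -M (c ·M N)) ▷ v) i ≡ (M ▷ v) i ℤ.+ (ℤ.- c) ℤ.* (N ▷ v) i
-M-·M-▷ c M N v i = begin
  ((M -M (c ·M N)) ▷ v) i             ≡⟨ ▷-congˡ (λ i j → cong (λ z → M i j ℤ.+ z) (ℤ.neg-distribˡ-* c (N i j))) v i ⟩
  ((M +M ((ℤ.- c) ·M N)) ▷ v) i       ≡⟨ +M-▷ M ((ℤ.- c) ·M N) v i ⟩
  (M ▷ v) i ℤ.+ (((ℤ.- c) ·M N) ▷ v) i  ≡⟨ cong (λ z → (M ▷ v) i ℤ.+ z) (·M-▷ (ℤ.- c) N v i) ⟩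
  (M ▷ v) i ℤ.+ (ℤ.- c) ℤ.* (N ▷ v) i ∎
  where open ≡-Reasoning

idM-▷ : ∀ {n} (v : Vect n) → idM ▷ v ≗ v
idM-▷ v i = trans (sum-supported₁ (λ j → idM i j ℤ.* v j) i off) on
  where
  off : ∀ j → j ≢ i → idM i j ℤ.* v j ≡ + 0
  off j j≢i with i Fin.≟ j
  ... | yes i≡j = contradiction (sym i≡j) j≢i
  ... | no _ = refl
  on : idM i i ℤ.* v i ≡ v i
  on with i Fin.≟ i
  ... | yes _ = ℤ.*-identityˡ (v i)
  ... | no i≢i = contradiction refl i≢i

Gpoly-▷-suc : ∀ {n} d (A : Mat n) m v i → (Gpoly d A (suc (suc m)) ▷ v) i ≡
  (A ▷ Gpoly d A (suc m) ▷ v) i ℤ.+ (ℤ.- + (d ℕ.∸ 1)) ℤ.* (Gpoly d A m ▷ v) i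
Gpoly-▷-suc d A m v i = trans (-M-·M-▷ (+ (d ℕ.∸ 1)) (A *M Gpoly d A (suc m)) (Gpoly d A m) v i)
  (cong (λ z → z ℤ.+ (ℤ.- + (d ℕ.∸ 1)) ℤ.* (Gpoly d A m ▷ v) i) (*M-▷ A (Gpoly d A (suc m)) v i))

-- G(A) is a polynomial in A; the proof follows the three-term recurrence. Through this, A preserves
-- the (-2)-eigenspace of B.
Gpoly-▷-comm : ∀ {n} d (A : Mat n) m v → Gpoly d A m ▷ A ▷ v ≗ A ▷ Gpoly d A m ▷ v
Gpoly-▷-comm d A zero v i = trans (idM-▷ (A ▷ v) i) (sym (▷-cong A (idM-▷ v) i))
Gpoly-▷-comm d A (suc zero) v i = begin
  ((A +M idM) ▷ A ▷ v) i                        ≡⟨ +M-▷ A idM (A ▷ v) i ⟩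
  (A ▷ A ▷ v) i ℤ.+ (idM ▷ A ▷ v) i             ≡⟨ cong (λ z → (A ▷ A ▷ v) i ℤ.+ z) (Gpoly-▷-comm d A zero v i) ⟩
  (A ▷ A ▷ v) i ℤ.+ (A ▷ idM ▷ v) i             ≡⟨ ▷-+ A (A ▷ v) (idM ▷ v) i ⟨
  (A ▷ (λ j → (A ▷ v) j ℤ.+ (idM ▷ v) j)) i     ≡⟨ ▷-cong A (+M-▷ A idM v) i ⟨
  (A ▷ (A +M idM) ▷ v) i                        ∎
  where open ≡-Reasoning
Gpoly-▷-comm d A (suc (suc m)) v i = begin
  (Gpoly d A (suc (suc m)) ▷ A ▷ v) i
    ≡⟨ Gpoly-▷-suc d A m (A ▷ v) i ⟩
  (A ▷ Gpoly d A (suc m) ▷ A ▷ v) i ℤ.+ c ℤ.* (Gpoly d A m ▷ A ▷ v) i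
    ≡⟨ cong₂ (λ x y → x ℤ.+ c ℤ.* y) (▷-cong A (Gpoly-▷-comm d A (suc m) v) i) (Gpoly-▷-comm d A m v i) ⟩
  (A ▷ A ▷ Gpoly d A (suc m) ▷ v) i ℤ.+ c ℤ.* (A ▷ Gpoly d A m ▷ v) i
    ≡⟨ cong (λ z → (A ▷ A ▷ Gpoly d A (suc m) ▷ v) i ℤ.+ z) (▷-·v A c (Gpoly d A m ▷ v) i) ⟨
  (A ▷ A ▷ Gpoly d A (suc m) ▷ v) i ℤ.+ (A ▷ c ·v Gpoly d A m ▷ v) i
    ≡⟨ ▷-+ A (A ▷ Gpoly d A (suc m) ▷ v) (c ·v Gpoly d A m ▷ v) i ⟨
  (A ▷ (λ j → (A ▷ Gpoly d A (suc m) ▷ v) j ℤ.+ c ℤ.* (Gpoly d A m ▷ v) j)) i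
    ≡⟨ ▷-cong A (Gpoly-▷-suc d A m v) i ⟨
  (A ▷ Gpoly d A (suc (suc m)) ▷ v) i ∎
  where
  open ≡-Reasoning
  c = ℤ.- + (d ℕ.∸ 1)

Gpoly-▷-eigen : ∀ {n} d (A : Mat n) x {v} → A ▷ v ≗ x ·v v → ∀ m → Gpoly d A m ▷ v ≗ Gval d x m ·v v
Gpoly-▷-eigen d A x {v} Av zero i = trans (idM-▷ v i) (sym (ℤ.*-identityˡ (v i)))
Gpoly-▷-eigen d A x {v} Av (suc zero) i = begin
  ((A +M idM) ▷ v) i                ≡⟨ +M-▷ A idM v i ⟩
  (A ▷ v) i ℤ.+ (idM ▷ v) i         ≡⟨ cong₂ ℤ._+_ (Av i) (Gpoly-▷-eigen d A x Av zero i) ⟩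
  x ℤ.* v i ℤ.+ + 1 ℤ.* v i         ≡⟨ ℤ.*-distribʳ-+ (v i) x (+ 1) ⟨
  (x ℤ.+ + 1) ℤ.* v i               ∎
  where open ≡-Reasoning
Gpoly-▷-eigen d A x {v} Av (suc (suc m)) i = begin
  (Gpoly d A (suc (suc m)) ▷ v) i
    ≡⟨ Gpoly-▷-suc d A m v i ⟩
  (A ▷ Gpoly d A (suc m) ▷ v) i ℤ.+ (ℤ.- c) ℤ.* (Gpoly d A m ▷ v) i
    ≡⟨ cong₂ (λ y z → y ℤ.+ (ℤ.- c) ℤ.* z)
         (trans (▷-cong A (Gpoly-▷-eigen d A x Av (suc m)) i) (▷-·v A (Gval d x (suc m)) v i))
         (Gpoly-▷-eigen d A x Av m i) ⟩
  Gval d x (suc m) ℤ.* (A ▷ v) i ℤ.+ (ℤ.- c) ℤ.* (Gval d x m ℤ.* v i)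
    ≡⟨ cong (λ z → Gval d x (suc m) ℤ.* z ℤ.+ (ℤ.- c) ℤ.* (Gval d x m ℤ.* v i)) (Av i) ⟩
  Gval d x (suc m) ℤ.* (x ℤ.* v i) ℤ.+ (ℤ.- c) ℤ.* (Gval d x m ℤ.* v i)
    ≡⟨ factor x c (Gval d x (suc m)) (Gval d x m) (v i) ⟩
  (x ℤ.* Gval d x (suc m) ℤ.+ ℤ.- (c ℤ.* Gval d x m)) ℤ.* v i ∎
  where
  open ≡-Reasoning
  c = + (d ℕ.∸ 1)
  factor : ∀ x c g h v → g ℤ.* (x ℤ.* v) ℤ.+ (ℤ.- c) ℤ.* (h ℤ.* v) ≡ (x ℤ.* g ℤ.+ ℤ.- (c ℤ.* h)) ℤ.* v
  factor = solve-∀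

-- Adjacency matrices of regular graphs.

module _ {n d} (Γ : Graph n) (regular : Regular d Γ) where

  private A = adjMat Γ

  ind : Fin n → Fin n → ℕ
  ind i j = if adj Γ i j then 1 else 0

  A≡+ind : ∀ i j → A i j ≡ + ind i j
  A≡+ind i j with adj Γ i j
  ... | true = refl
  ... | false = refl

  ind-sym : ∀ i j → ind i j ≡ ind j i
  ind-sym i j = cong (if_then 1 else 0) (Graph.sym Γ i j)

  sum-ind : ∀ i → ℕSum.sum (ind i) ≡ d
  sum-ind i = trans (sym (sumFin≡foldr ℕ._+_ 0 n (ind i))) (regular i)

  -- Triangle inequality over the d ones of a row. Applied to a vector of signs, it confines the
  -- eigenvalue to the range from -d to d.
  ∣A▷∣≤ : ∀ {v} → (∀ j → ∣ v j ∣ ≤ 1) → ∀ i → ∣ (A ▷ v) i ∣ ≤ d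
  ∣A▷∣≤ {v} v≤1 i = subst (∣ (A ▷ v) i ∣ ≤_) (sum-ind i) (∣sum∣≤ (λ j → A i j ℤ.* v j) (ind i) bound)
    where
    bound : ∀ j → ∣ A i j ℤ.* v j ∣ ≤ ind i j
    bound j with adj Γ i j
    ... | true = subst (λ z → ∣ z ∣ ≤ 1) (sym (ℤ.*-identityˡ (v j))) (v≤1 j)
    ... | false = z≤n

  -- Columns of A also sum to d, by symmetry. Hence A preserves the vectors of sum zero, those that
  -- J annihilates.
  sum-A▷ : ∀ v → sum (A ▷ v) ≡ + d ℤ.* sum v
  sum-A▷ v = begin
    sum (λ i → sum (λ j → A i j ℤ.* v j))    ≡⟨ ∑-comm (λ i j → A i j ℤ.* v j) ⟩
    sum (λ j → sum (λ i → A i j ℤ.* v j))    ≡⟨ sum-cong-≗ (λ j → *-distribʳ-sum (v j) (λ i → A i j)) ⟨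
    sum (λ j → sum (λ i → A i j) ℤ.* v j)    ≡⟨ sum-cong-≗ (λ j → cong (ℤ._* v j) (column j)) ⟩
    sum (λ j → + d ℤ.* v j)                  ≡⟨ *-distribˡ-sum (+ d) v ⟨
    + d ℤ.* sum v                            ∎
    where
    open ≡-Reasoning
    column : ∀ j → sum (λ i → A i j) ≡ + d
    column j = trans (sum-cong-≗ (λ i → trans (A≡+ind i j) (cong +_ (ind-sym i j))))
                     (trans (pos-sum (ind j)) (cong +_ (sum-ind j)))

  -- The ones of A number n·d counted by rows, and they pair off across the zero diagonal.
  handshake : 2 ∣ d ℕ.* n
  handshake with q , eq ← 2∣sum-sym ind ind-sym (λ i → cong (if_then 1 else 0) (irrefl Γ i)) =
    divides q (trans (trans (ℕ.*-comm d n) (sym (trans (ℕSum.sum-cong-≗ sum-ind) (const-sum n)))) eq)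
    where
    const-sum : ∀ n → ℕSum.sum {n} (λ _ → d) ≡ n ℕ.* d
    const-sum zero = refl
    const-sum (suc n) = cong (d ℕ.+_) (const-sum n)

-- Positions on a cycle and alternating signs.

cycSucc-functional : ∀ {m} {k l l′ : Fin m} → CycSucc m k l → CycSucc m k l′ → l ≡ l′
cycSucc-functional (inj₁ p) (inj₁ q) = Fin.toℕ-injective (trans p (sym q))
cycSucc-functional {l = l} (inj₁ p) (inj₂ (e , _)) = ⊥-elim (ℕ.<⇒≢ (Fin.toℕ<n l) (trans p e))
cycSucc-functional {l′ = l′} (inj₂ (e , _)) (inj₁ q) = ⊥-elim (ℕ.<⇒≢ (Fin.toℕ<n l′) (trans q e))
cycSucc-functional (inj₂ (_ , z)) (inj₂ (_ , z′)) = Fin.toℕ-injective (trans z (sym z′))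

cycSucc-injective : ∀ {m} {k k′ l : Fin m} → CycSucc m k l → CycSucc m k′ l → k ≡ k′
cycSucc-injective (inj₁ p) (inj₁ q) = Fin.toℕ-injective (ℕ.suc-injective (trans (sym p) q))
cycSucc-injective (inj₁ p) (inj₂ (_ , z)) = contradiction (trans (sym p) z) λ ()
cycSucc-injective (inj₂ (_ , z)) (inj₁ q) = contradiction (trans (sym q) z) λ ()
cycSucc-injective (inj₂ (e , _)) (inj₂ (e′ , _)) = Fin.toℕ-injective (ℕ.suc-injective (trans e (sym e′)))

-- Two steps returning to the start would force m = 2 if one of them wraps around and m = 1 if both
-- do. This keeps the two neighbours of a vertex distinct.
cycSucc-no-2-cycle : ∀ {m} {k l : Fin m} → 3 ≤ m → CycSucc m k l → ¬ CycSucc m l k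
cycSucc-no-2-cycle 3≤m (inj₁ p) (inj₁ q) = ℕ.<-irrefl (trans q (cong suc p)) (s≤s (ℕ.n≤1+n _))
cycSucc-no-2-cycle 3≤m (inj₁ p) (inj₂ (e , z)) =
  ℕ.<⇒≢ 3≤m (trans (cong suc (sym (trans p (cong suc z)))) e)
cycSucc-no-2-cycle 3≤m (inj₂ (e , z)) (inj₁ q) =
  ℕ.<⇒≢ 3≤m (trans (cong suc (sym (trans q (cong suc z)))) e)
cycSucc-no-2-cycle 3≤m (inj₂ (e , z)) (inj₂ (e′ , z′)) =
  ℕ.<⇒≢ (ℕ.<⇒≤ 3≤m) (trans (cong suc (sym z)) e′)

toℕ-mod : ∀ i n .{{_ : NonZero n}} → toℕ (i mod n) ≡ i % n
toℕ-mod i n = Fin.toℕ-fromℕ< (m%n<n i n)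

mod-cong : ∀ {i j} n .{{_ : NonZero n}} → i % n ≡ j % n → i mod n ≡ j mod n
mod-cong {i} {j} n eq = Fin.toℕ-injective (trans (toℕ-mod i n) (trans eq (sym (toℕ-mod j n))))

toℕ-mod-id : ∀ {n} .{{_ : NonZero n}} (k : Fin n) → toℕ k mod n ≡ k
toℕ-mod-id {n} k = Fin.toℕ-injective (trans (toℕ-mod (toℕ k) n) (m<n⇒m%n≡m (Fin.toℕ<n k)))

suc-% : ∀ i n .{{_ : NonZero n}} → suc i % n ≡ suc (i % n) % n
suc-% i n = begin
  (1 ℕ.+ i) % n                ≡⟨ %-distribˡ-+ 1 i n ⟩
  (1 % n ℕ.+ i % n) % n        ≡⟨ cong (λ z → (1 % n ℕ.+ z) % n) (m%n%n≡m%n i n) ⟨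
  (1 % n ℕ.+ i % n % n) % n    ≡⟨ %-distribˡ-+ 1 (i % n) n ⟨
  suc (i % n) % n              ∎
  where open ≡-Reasoning

-- With positions indexed by all naturals, the wrap-around needs no special case afterwards: moving
-- to the next vertex is always `suc`.
cycSucc-mod : ∀ i n .{{_ : NonZero n}} → CycSucc n (i mod n) (suc i mod n)
cycSucc-mod i n with ℕ.m≤n⇒m<n∨m≡n (m%n<n i n)
... | inj₁ lt = inj₁ (trans (toℕ-mod (suc i) n) (trans (trans (suc-% i n) (m<n⇒m%n≡m lt)) (cong suc (sym (toℕ-mod i n)))))
... | inj₂ eq = inj₂ (trans (cong suc (toℕ-mod i n)) eq ,
                      trans (toℕ-mod (suc i) n) (trans (suc-% i n) (trans (cong (_% n) eq) (n%n≡0 n))))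

-- The geometric sum of ratio -1, multiplied by 1 - (-1) = 2 to avoid a division.
2*sum-alternating : ∀ n → + 2 ℤ.* sum {n} (λ k → -1ℤ ℤ.^ toℕ k) ≡ + 1 ℤ.+ ℤ.- (-1ℤ ℤ.^ n)
2*sum-alternating zero = refl
2*sum-alternating (suc n) = begin
  + 2 ℤ.* (+ 1 ℤ.+ sum {n} (λ k → -1ℤ ℤ.* -1ℤ ℤ.^ toℕ k))
    ≡⟨ cong (λ z → + 2 ℤ.* (+ 1 ℤ.+ z)) (*-distribˡ-sum {n} -1ℤ (λ k → -1ℤ ℤ.^ toℕ k)) ⟨
  + 2 ℤ.* (+ 1 ℤ.+ -1ℤ ℤ.* s)                        ≡⟨ expand s ⟩
  + 2 ℤ.+ -1ℤ ℤ.* (+ 2 ℤ.* s)                        ≡⟨ cong (λ z → + 2 ℤ.+ -1ℤ ℤ.* z) (2*sum-alternating n) ⟩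
  + 2 ℤ.+ -1ℤ ℤ.* (+ 1 ℤ.+ ℤ.- (-1ℤ ℤ.^ n))          ≡⟨ collect (-1ℤ ℤ.^ n) ⟩
  + 1 ℤ.+ ℤ.- (-1ℤ ℤ.* -1ℤ ℤ.^ n)                    ∎
  where
  open ≡-Reasoning
  s = sum {n} (λ k → -1ℤ ℤ.^ toℕ k)
  expand : ∀ s → + 2 ℤ.* (+ 1 ℤ.+ -1ℤ ℤ.* s) ≡ + 2 ℤ.+ -1ℤ ℤ.* (+ 2 ℤ.* s)
  expand = solve-∀
  collect : ∀ p → + 2 ℤ.+ -1ℤ ℤ.* (+ 1 ℤ.+ ℤ.- p) ≡ + 1 ℤ.+ ℤ.- (-1ℤ ℤ.* p)
  collect = solve-∀

-1^even : ∀ {n} → 2 ∣ n → -1ℤ ℤ.^ n ≡ + 1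
-1^even (divides m refl) = trans (cong (-1ℤ ℤ.^_) (ℕ.*-comm m 2)) (trans (sym (ℤ.^-*-assoc -1ℤ 2 m)) (ℤ.^-zeroˡ m))

∣-1^_∣ : ∀ n → ∣ -1ℤ ℤ.^ n ∣ ≡ 1
∣-1^ zero ∣ = refl
∣-1^ suc n ∣ = trans (ℤ.abs-* -1ℤ (-1ℤ ℤ.^ n)) (cong (1 ℕ.*_) ∣-1^ n ∣)

-- The characteristic polynomial (t + 1)² has the double root -1, so solutions have the form (-1)ⁱ(α
-- + βi); the first two terms give α = x₀ and β = -(x₀ + x₁).
2-step-solution : (x : ℕ → ℤ) → (∀ i → x i ℤ.+ x (2 ℕ.+ i) ≡ (ℤ.- + 2) ℤ.* x (suc i)) →
  ∀ i → x i ≡ -1ℤ ℤ.^ i ℤ.* (x 0 ℤ.+ ℤ.- (+ i ℤ.* (x 0 ℤ.+ x 1)))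
2-step-solution x rec zero = base (x 0)
  where
  base : ∀ a → a ≡ + 1 ℤ.* (a ℤ.+ + 0)
  base = solve-∀
2-step-solution x rec (suc zero) = base (x 0) (x 1)
  where
  base : ∀ a b → b ≡ -1ℤ ℤ.* (a ℤ.+ ℤ.- (+ 1 ℤ.* (a ℤ.+ b)))
  base = solve-∀
2-step-solution x rec (suc (suc i)) = begin
  x (2 ℕ.+ i)                                           ≡⟨ isolate (x i) (x (2 ℕ.+ i)) ⟩
  (x i ℤ.+ x (2 ℕ.+ i)) ℤ.+ ℤ.- x i                     ≡⟨ cong (ℤ._+ ℤ.- x i) (rec i) ⟩
  (ℤ.- + 2) ℤ.* x (suc i) ℤ.+ ℤ.- x i
    ≡⟨ cong₂ (λ y z → (ℤ.- + 2) ℤ.* y ℤ.+ ℤ.- z) (2-step-solution x rec (suc i)) (2-step-solution x rec i) ⟩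
  (ℤ.- + 2) ℤ.* (-1ℤ ℤ.* p ℤ.* (x 0 ℤ.+ ℤ.- ((+ 1 ℤ.+ + i) ℤ.* y))) ℤ.+ ℤ.- (p ℤ.* (x 0 ℤ.+ ℤ.- (+ i ℤ.* y)))
    ≡⟨ step-eq (x 0) y (+ i) p ⟩
  -1ℤ ℤ.* (-1ℤ ℤ.* p) ℤ.* (x 0 ℤ.+ ℤ.- ((+ 2 ℤ.+ + i) ℤ.* y)) ∎
  where
  open ≡-Reasoning
  y = x 0 ℤ.+ x 1
  p = -1ℤ ℤ.^ i
  isolate : ∀ a b → b ≡ (a ℤ.+ b) ℤ.+ ℤ.- a
  isolate = solve-∀
  step-eq : ∀ a y i p →
    (ℤ.- + 2) ℤ.* (-1ℤ ℤ.* p ℤ.* (a ℤ.+ ℤ.- ((+ 1 ℤ.+ i) ℤ.* y))) ℤ.+ ℤ.- (p ℤ.* (a ℤ.+ ℤ.- (i ℤ.* y))) ≡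
    -1ℤ ℤ.* (-1ℤ ℤ.* p) ℤ.* (a ℤ.+ ℤ.- ((+ 2 ℤ.+ i) ℤ.* y))
  step-eq = solve-∀

-- Cycle matrices of even order and their eigenvalue -2.

module CycleMatrix {n} (3≤n : 3 ≤ n) (2∣n : 2 ∣ n) (B : Mat n) (σ : Permutation′ n)
  (entries : ∀ k l → (CycConsec n k l → B (σ ⟨$⟩ʳ k) (σ ⟨$⟩ʳ l) ≡ + 1) ×
                     (¬ CycConsec n k l → B (σ ⟨$⟩ʳ k) (σ ⟨$⟩ʳ l) ≡ + 0)) where

  instance
    n≢0 : NonZero n
    n≢0 = >-nonZero (ℕ.≤-trans (s≤s z≤n) 3≤n)

  -- The cycle unrolled into an n-periodic sequence, on which B acts as a recurrence.
  vertex : ℕ → Fin n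
  vertex i = σ ⟨$⟩ʳ (i mod n)

  vertex-position : ∀ p → vertex (toℕ (σ ⟨$⟩ˡ p)) ≡ p
  vertex-position p = trans (cong (σ ⟨$⟩ʳ_) (toℕ-mod-id (σ ⟨$⟩ˡ p))) (inverseʳ σ)

  vertex-n+ : ∀ i → vertex (n ℕ.+ i) ≡ vertex i
  vertex-n+ i = cong (σ ⟨$⟩ʳ_) (mod-cong n (trans (cong (_% n) (ℕ.+-comm n i)) ([m+n]%n≡m%n i n)))

  -- Lets `B▷-vertex` reach every row. The index is n - 1 + position, one lap ahead, since position
  -- - 1 would be truncated at the first vertex.
  vertex-suc-surjective : ∀ p → ∃ λ i → vertex (suc i) ≡ p
  vertex-suc-surjective p = ℕ.pred n ℕ.+ toℕ (σ ⟨$⟩ˡ p) ,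
    trans (cong (λ m → vertex (m ℕ.+ toℕ (σ ⟨$⟩ˡ p))) (ℕ.suc-pred n))
          (trans (vertex-n+ _) (vertex-position p))

  -- After reindexing by σ, the row at position i + 1 has its ones exactly at positions i and i + 2,
  -- which differ because n ≥ 3.
  B▷-vertex : ∀ w i → (B ▷ w) (vertex (suc i)) ≡ w (vertex i) ℤ.+ w (vertex (2 ℕ.+ i))
  B▷-vertex w i = begin
    sum (λ j → B (σ ⟨$⟩ʳ c) j ℤ.* w j)
      ≡⟨ sum-permute (λ j → B (σ ⟨$⟩ʳ c) j ℤ.* w j) σ ⟩
    sum (λ l → B (σ ⟨$⟩ʳ c) (σ ⟨$⟩ʳ l) ℤ.* w (σ ⟨$⟩ʳ l))
      ≡⟨ sum-supported₂ (λ l → B (σ ⟨$⟩ʳ c) (σ ⟨$⟩ʳ l) ℤ.* w (σ ⟨$⟩ʳ l)) a≢b (λ l l≢a l≢b →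
           cong (ℤ._* w (σ ⟨$⟩ʳ l)) (proj₂ (entries c l) (λ where
             (inj₁ cl) → l≢b (cycSucc-functional cl cb)
             (inj₂ lc) → l≢a (cycSucc-injective lc ac)))) ⟩
    B (σ ⟨$⟩ʳ c) (σ ⟨$⟩ʳ a) ℤ.* w (vertex i) ℤ.+ B (σ ⟨$⟩ʳ c) (σ ⟨$⟩ʳ b) ℤ.* w (vertex (2 ℕ.+ i))
      ≡⟨ cong₂ (λ x y → x ℤ.* w (vertex i) ℤ.+ y ℤ.* w (vertex (2 ℕ.+ i)))
           (proj₁ (entries c a) (inj₂ ac)) (proj₁ (entries c b) (inj₁ cb)) ⟩
    + 1 ℤ.* w (vertex i) ℤ.+ + 1 ℤ.* w (vertex (2 ℕ.+ i))
      ≡⟨ cong₂ ℤ._+_ (ℤ.*-identityˡ (w (vertex i))) (ℤ.*-identityˡ (w (vertex (2 ℕ.+ i)))) ⟩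
    w (vertex i) ℤ.+ w (vertex (2 ℕ.+ i)) ∎
    where
    open ≡-Reasoning
    a = i mod n
    c = suc i mod n
    b = (2 ℕ.+ i) mod n
    ac : CycSucc n a c
    ac = cycSucc-mod i n
    cb : CycSucc n c b
    cb = cycSucc-mod (suc i) n
    a≢b : a ≢ b
    a≢b a≡b = cycSucc-no-2-cycle 3≤n ac (subst (CycSucc n c) (sym a≡b) cb)

  alt : Vect n
  alt p = -1ℤ ℤ.^ toℕ (σ ⟨$⟩ˡ p)

  -- As n is even, each full lap contributes a factor (-1)ⁿ = 1, so the sign depends on i only
  -- through its position on the cycle.
  alt-vertex : ∀ i → alt (vertex i) ≡ -1ℤ ℤ.^ i
  alt-vertex i = sym (begin
    -1ℤ ℤ.^ i                                     ≡⟨ cong (-1ℤ ℤ.^_) (m≡m%n+[m/n]*n i n) ⟩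
    -1ℤ ℤ.^ (i % n ℕ.+ i / n ℕ.* n)               ≡⟨ ℤ.^-distribˡ-+-* -1ℤ (i % n) (i / n ℕ.* n) ⟩
    -1ℤ ℤ.^ (i % n) ℤ.* -1ℤ ℤ.^ (i / n ℕ.* n)     ≡⟨ cong (-1ℤ ℤ.^ (i % n) ℤ.*_) periods ⟩
    -1ℤ ℤ.^ (i % n) ℤ.* + 1                       ≡⟨ ℤ.*-identityʳ _ ⟩
    -1ℤ ℤ.^ (i % n)                               ≡⟨ cong (-1ℤ ℤ.^_) (trans (sym (toℕ-mod i n)) (cong toℕ (sym (inverseˡ σ)))) ⟩
    alt (vertex i)                                ∎)
    where
    open ≡-Reasoning
    periods : -1ℤ ℤ.^ (i / n ℕ.* n) ≡ + 1
    periods = trans (cong (-1ℤ ℤ.^_) (ℕ.*-comm (i / n) n))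
      (trans (sym (ℤ.^-*-assoc -1ℤ n (i / n))) (trans (cong (ℤ._^ (i / n)) (-1^even 2∣n)) (ℤ.^-zeroˡ (i / n))))

  B▷alt : B ▷ alt ≗ (ℤ.- + 2) ·v alt
  B▷alt p with i , refl ← vertex-suc-surjective p = begin
    (B ▷ alt) (vertex (suc i))                       ≡⟨ B▷-vertex alt i ⟩
    alt (vertex i) ℤ.+ alt (vertex (2 ℕ.+ i))        ≡⟨ cong₂ ℤ._+_ (alt-vertex i) (alt-vertex (2 ℕ.+ i)) ⟩
    -1ℤ ℤ.^ i ℤ.+ -1ℤ ℤ.* (-1ℤ ℤ.* -1ℤ ℤ.^ i)        ≡⟨ flip (-1ℤ ℤ.^ i) ⟩
    (ℤ.- + 2) ℤ.* (-1ℤ ℤ.* -1ℤ ℤ.^ i)                ≡⟨ cong ((ℤ.- + 2) ℤ.*_) (alt-vertex (suc i)) ⟨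
    (ℤ.- + 2) ℤ.* alt (vertex (suc i))               ∎
    where
    open ≡-Reasoning
    flip : ∀ p → p ℤ.+ -1ℤ ℤ.* (-1ℤ ℤ.* p) ≡ (ℤ.- + 2) ℤ.* (-1ℤ ℤ.* p)
    flip = solve-∀

  sum-alt : sum alt ≡ + 0
  sum-alt = ℤ.*-cancelˡ-≡ (+ 2) (sum alt) (+ 0) (begin
    + 2 ℤ.* sum alt
      ≡⟨ cong (+ 2 ℤ.*_) (trans (sum-permute alt σ)
           (sum-cong-≗ {n} (λ k → cong (λ l → -1ℤ ℤ.^ toℕ l) (inverseˡ σ {k})))) ⟩
    + 2 ℤ.* sum {n} (λ k → -1ℤ ℤ.^ toℕ k)    ≡⟨ 2*sum-alternating n ⟩
    + 1 ℤ.+ ℤ.- (-1ℤ ℤ.^ n)                  ≡⟨ cong (λ z → + 1 ℤ.+ ℤ.- z) (-1^even 2∣n) ⟩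
    + 0                                      ∎)
    where open ≡-Reasoning

  -- Along the unrolled cycle w satisfies the recurrence of `2-step-solution`. After n steps, n
  -- even, it must return to its initial value, so n·y = 0; the linear term vanishes and only the
  -- alternating solution is left.
  eigenspace : ∀ w → B ▷ w ≗ (ℤ.- + 2) ·v w → w ≗ w (vertex 0) ·v alt
  eigenspace w Bw p = begin
    w p                                       ≡⟨ cong w (vertex-position p) ⟨
    x i                                       ≡⟨ solution i ⟩
    -1ℤ ℤ.^ i ℤ.* (x 0 ℤ.+ ℤ.- (+ i ℤ.* y))   ≡⟨ cong (λ z → -1ℤ ℤ.^ i ℤ.* (x 0 ℤ.+ ℤ.- (+ i ℤ.* z))) y≡0 ⟩
    -1ℤ ℤ.^ i ℤ.* (x 0 ℤ.+ ℤ.- (+ i ℤ.* + 0)) ≡⟨ simplify (-1ℤ ℤ.^ i) (x 0) (+ i) ⟩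
    x 0 ℤ.* -1ℤ ℤ.^ i                         ∎
    where
    open ≡-Reasoning
    x : ℕ → ℤ
    x j = w (vertex j)
    y = x 0 ℤ.+ x 1
    i = toℕ (σ ⟨$⟩ˡ p)
    solution : ∀ j → x j ≡ -1ℤ ℤ.^ j ℤ.* (x 0 ℤ.+ ℤ.- (+ j ℤ.* y))
    solution = 2-step-solution x (λ j → trans (sym (B▷-vertex w j)) (Bw (vertex (suc j))))
    cancel : ∀ a b → b ≡ a ℤ.+ ℤ.- (+ 1 ℤ.* (a ℤ.+ ℤ.- b))
    cancel = solve-∀
    simplify : ∀ p a j → p ℤ.* (a ℤ.+ ℤ.- (j ℤ.* + 0)) ≡ a ℤ.* p
    simplify = solve-∀
    y≡0 : y ≡ + 0
    y≡0 = ℤ.*-cancelˡ-≡ (+ n) y (+ 0) (begin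
      + n ℤ.* y                                             ≡⟨ cancel (x 0) (+ n ℤ.* y) ⟩
      x 0 ℤ.+ ℤ.- (+ 1 ℤ.* (x 0 ℤ.+ ℤ.- (+ n ℤ.* y)))
        ≡⟨ cong (λ z → x 0 ℤ.+ ℤ.- (z ℤ.* (x 0 ℤ.+ ℤ.- (+ n ℤ.* y)))) (-1^even 2∣n) ⟨
      x 0 ℤ.+ ℤ.- (-1ℤ ℤ.^ n ℤ.* (x 0 ℤ.+ ℤ.- (+ n ℤ.* y)))
        ≡⟨ cong (λ z → x 0 ℤ.+ ℤ.- z) (solution n) ⟨
      x 0 ℤ.+ ℤ.- x n
        ≡⟨ cong (λ q → x 0 ℤ.+ ℤ.- w q) (trans (cong vertex (sym (ℕ.+-identityʳ n))) (vertex-n+ 0)) ⟩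
      x 0 ℤ.+ ℤ.- x 0                                       ≡⟨ ℤ.+-inverseʳ (x 0) ⟩
      + 0                                                   ≡⟨ ℤ.*-zeroʳ (+ n) ⟨
      + n ℤ.* + 0                                           ∎)

-- The integer eigenvalue and the contradiction.

Gval²≡4 : ∀ {n d} m (Γ : Graph n) → Regular d Γ → 2 ∣ n →
  ∀ ε → ε ℤ.* ε ≡ + 1 → ∀ B → IsCycleMatrix n B →
  Gpoly d (adjMat Γ) m ≐ (J n +M (ε ·M B)) →
  ∃ λ x → ∣ x ∣ ≤ d × Gval d x m ℤ.* Gval d x m ≡ + 4
Gval²≡4 {n} {d} m Γ regular 2∣n ε ε² B (3≤n , σ , entries) GA = x , ∣x∣≤d , Gx²
  where
  open ≡-Reasoning
  open CycleMatrix 3≤n 2∣n B σ entries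
  A = adjMat Γ
  w = A ▷ alt
  -- `alt` is 1 at `vertex 0`, so this entry is the factor once w is known to be a multiple of
  -- `alt`; as an entry of an integer vector it is an integer from the outset.
  x = w (vertex 0)

  ∣x∣≤d : ∣ x ∣ ≤ d
  ∣x∣≤d = ∣A▷∣≤ Γ regular (λ p → ℕ.≤-reflexive ∣-1^ toℕ (σ ⟨$⟩ˡ p) ∣) (vertex 0)

  -- J vanishes on vectors of sum zero, leaving εB, where ε is 1 for defect and -1 for excess.
  GA▷ : ∀ {v} → sum v ≡ + 0 → Gpoly d A m ▷ v ≗ ε ·v (B ▷ v)
  GA▷ {v} Σv i = begin
    (Gpoly d A m ▷ v) i                     ≡⟨ ▷-congˡ GA v i ⟩
    ((J n +M (ε ·M B)) ▷ v) i               ≡⟨ +M-▷ (J n) (ε ·M B) v i ⟩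
    (J n ▷ v) i ℤ.+ ((ε ·M B) ▷ v) i
      ≡⟨ cong₂ ℤ._+_ (trans (sum-cong-≗ (λ j → ℤ.*-identityˡ (v j))) Σv) (·M-▷ ε B v i) ⟩
    + 0 ℤ.+ ε ℤ.* (B ▷ v) i                 ≡⟨ ℤ.+-identityˡ _ ⟩
    ε ℤ.* (B ▷ v) i                         ∎

  GA▷alt : Gpoly d A m ▷ alt ≗ (ε ℤ.* (ℤ.- + 2)) ·v alt
  GA▷alt i = trans (GA▷ sum-alt i) (trans (cong (ε ℤ.*_) (B▷alt i)) (sym (ℤ.*-assoc ε (ℤ.- + 2) (alt i))))

  sum-w : sum w ≡ + 0
  sum-w = trans (sum-A▷ Γ regular alt) (trans (cong (+ d ℤ.*_) sum-alt) (ℤ.*-zeroʳ (+ d)))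

  B▷w : B ▷ w ≗ (ℤ.- + 2) ·v w
  -- Since ε² = 1, B can be traded for εG(A) on w, G(A) moved past A, and ε removed again.
  B▷w i = begin
    (B ▷ w) i                                       ≡⟨ ε²-cancel ((B ▷ w) i) ⟨
    ε ℤ.* (ε ℤ.* (B ▷ w) i)                         ≡⟨ cong (ε ℤ.*_) (GA▷ sum-w i) ⟨
    ε ℤ.* (Gpoly d A m ▷ w) i                       ≡⟨ cong (ε ℤ.*_) (Gpoly-▷-comm d A m alt i) ⟩
    ε ℤ.* (A ▷ Gpoly d A m ▷ alt) i
      ≡⟨ cong (ε ℤ.*_) (trans (▷-cong A GA▷alt i) (▷-·v A (ε ℤ.* (ℤ.- + 2)) alt i)) ⟩
    ε ℤ.* (ε ℤ.* (ℤ.- + 2) ℤ.* w i)                 ≡⟨ cong (ε ℤ.*_) (ℤ.*-assoc ε (ℤ.- + 2) (w i)) ⟩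
    ε ℤ.* (ε ℤ.* ((ℤ.- + 2) ℤ.* w i))               ≡⟨ ε²-cancel ((ℤ.- + 2) ℤ.* w i) ⟩
    (ℤ.- + 2) ℤ.* w i                               ∎
    where
    ε²-cancel : ∀ y → ε ℤ.* (ε ℤ.* y) ≡ y
    ε²-cancel y = trans (sym (ℤ.*-assoc ε ε y)) (trans (cong (ℤ._* y) ε²) (ℤ.*-identityˡ y))

  -- Both eigenvalues of G(A) on `alt` are compared at `vertex 0`, where `alt` is 1.
  Gx : Gval d x m ≡ ε ℤ.* (ℤ.- + 2)
  Gx = begin
    Gval d x m                                  ≡⟨ ℤ.*-identityʳ (Gval d x m) ⟨
    Gval d x m ℤ.* + 1                          ≡⟨ cong (Gval d x m ℤ.*_) (alt-vertex 0) ⟨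
    Gval d x m ℤ.* alt (vertex 0)               ≡⟨ Gpoly-▷-eigen d A x (eigenspace w B▷w) m (vertex 0) ⟨
    (Gpoly d A m ▷ alt) (vertex 0)              ≡⟨ GA▷alt (vertex 0) ⟩
    ε ℤ.* (ℤ.- + 2) ℤ.* alt (vertex 0)          ≡⟨ cong (ε ℤ.* (ℤ.- + 2) ℤ.*_) (alt-vertex 0) ⟩
    ε ℤ.* (ℤ.- + 2) ℤ.* + 1                     ≡⟨ ℤ.*-identityʳ _ ⟩
    ε ℤ.* (ℤ.- + 2)                             ∎

  -- Squaring removes ε, so that defect and excess share one numerical check.
  Gx² : Gval d x m ℤ.* Gval d x m ≡ + 4
  Gx² = trans (cong (λ g → g ℤ.* g) Gx) (trans (square ε) (cong (ℤ._* + 4) ε²))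
    where
    square : ∀ e → e ℤ.* (ℤ.- + 2) ℤ.* (e ℤ.* (ℤ.- + 2)) ≡ e ℤ.* e ℤ.* + 4
    square = solve-∀

no-9-regular : ∀ {n m} (Γ : Graph n) → 3 ≤ m → m ≤ 20000 → Regular 9 Γ →
  ∀ ε → ε ℤ.* ε ≡ + 1 → ∀ B → IsCycleMatrix n B → ¬ Gpoly 9 (adjMat Γ) m ≐ (J n +M (ε ·M B))
no-9-regular {m = m} Γ 3≤m m≤20000 regular ε ε² B cycle GA =
  -- The handshake count gives 2 ∣ 9n, and 2 is coprime to 9.
  let 2∣n = coprime-divisor (toWitness {a? = coprime? 2 9} _) (handshake Γ regular)
      x , ∣x∣≤9 , Gx² = Gval²≡4 m Γ regular 2∣n ε ε² B cycle GA
  in Gval²≢4 {x} ∣x∣≤9 3≤m m≤20000 Gx²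

theorem8 : ((D : ℕ) → 3 ≤ D → D ≤ 20000 →
    (n : ℕ) (G : Graph n) → ¬ CyclicDefect 9 D G)
    × ((g : ℕ) → Odd g → 7 ≤ g → g ≤ 40001 →
    (n : ℕ) (G : Graph n) → ¬ CyclicExcess 9 g G)
theorem8 =
  (λ D 3≤D D≤20000 n G (_ , regular , _ , _ , B , cycle , GA) →
    no-9-regular G 3≤D D≤20000 regular (+ 1) refl B cycle
      (λ i j → trans (GA i j) (cong (λ z → + 1 ℤ.+ z) (sym (ℤ.*-identityˡ (B i j)))))) ,
  (λ g _ 7≤g g≤40001 n G (_ , regular , _ , _ , _ , B , cycle , GA) →
    -- Rounding down, 7 / 2 = 3 and 40001 / 2 = 20000, so the index `g / 2` lies in the range
    -- already checked.
    no-9-regular G (/-monoˡ-≤ 2 7≤g) (/-monoˡ-≤ 2 g≤40001) regular -1ℤ refl B cycle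
      (λ i j → trans (GA i j) (cong (λ z → + 1 ℤ.+ z) (sym (ℤ.-1*i≡-i (B i j))))))
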